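{- Let $\overrightarrow{W}$ be a Morse sequence on a simplicial complex $K$ and let $\sigma,\tau$ be critical simplices of $\overrightarrow{W}$. Then $\sigma\in\widehat{\partial}(\tau)$ if and only if $\tau\in\widehat{\delta}(\sigma)$.
   Context: A simplicial complex $K$ is a finite collection of non-empty finite sets closed under taking non-empty subsets; $\dim\sigma=|\sigma|-1$, $K^{(p)}$ the set of $p$-simplices. A pair $(\sigma,\tau)$ with $\sigma\subsetneq\tau$ is a free pair for $K$ if $\tau$ is the only simplex other than $\sigma$ containing $\sigma$; $K$ is then an elementary expansion of $K\setminus\{\sigma,\tau\}$. If $\nu$ is a facet (maximal simplex) of $K$, $K$ is an elementary filling of $K\setminus\{\nu\}$. A Morse sequence on $K$ is a sequence $\langle\emptyset=K_0,\dots,K_k=K\rangle$ with each $K_i$ an elementary expansion or filling of $K_{i-1}$; simplices added by fillings are critical; for an expansion $K_i=K_{i-1}\cup\{\sigma,\tau\}$, $\sigma\subset\tau$, $(\sigma,\tau)$ is a regular pair, $\sigma$ lower regular, $\tau$ upper regular. $K[p]$ is the $\mathbb{Z}_2$-vector space of subsets of $K^{(p)}$ (sum = symmetric difference, $0=\emptyset$); $\partial(\sigma)=\{\tau\in K^{(p-1)}:\tau\subset\sigma\}$, $\delta(\sigma)=\{\tau\in K^{(p+1)}:\sigma\subset\tau\}$, extended linearly to chains. The reference map $\curlywedge$ is the unique map assigning to each $p$-simplex a set of critical $p$-simplices, extended linearly (mod 2) to chains, with $\curlywedge(\nu)=\{\nu\}$ for critical $\nu$ and $\curlywedge(\tau)=0=\curlywedge(\partial(\tau))$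 for upper regular $\tau$; the coreference map $\curlyvee$ is the unique such map with $\curlyvee(\nu)=\{\nu\}$ for critical $\nu$ and $\curlyvee(\sigma)=0=\curlyvee(\delta(\sigma))$ for lower regular $\sigma$. For a critical $p$-simplex $\nu$, $\widehat{\partial}(\nu)=\curlywedge(\partial(\nu))$ and $\widehat{\delta}(\nu)=\curlyvee(\delta(\nu))$. -}

module Defs where

open import Data.Bool using (Bool; T; _∧_; _xor_)
open import Data.Nat using (ℕ; zero; suc; _∸_; _≡ᵇ_)
open import Data.Fin.Subset using (Subset; inside; outside; ∣_∣; _⊆_; _⊂_; Nonempty)
open import Data.Fin.Subset.Properties using (_⊆?_)
open import Data.Vec using ([]; _∷_)
open import Data.Product using (_×_; _,_; ∃)
open import Data.Sum using (_⊎_)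
open import Data.Empty using (⊥)
open import Relation.Nullary using (¬_; does)
open import Relation.Binary.PropositionalEquality using (_≡_; _≢_)
open import Function.Bundles using (_⇔_)

private
  variable
    n : ℕ

-- Vertices are the elements of Fin n, so a finite set of vertices is a
-- Subset n.  A collection of such sets is given by its characteristic
-- function; this serves both for complexes and for mod 2 chains.
Family : ℕ → Set
Family n = Subset n → Bool

infix 4 _∈_ _∉_

_∈_ : Subset n → Family n → Set
σ ∈ c = T (c σ)

_∉_ : Subset n → Family n → Set
σ ∉ c = ¬ (σ ∈ c)

-- Only meaningful for non-empty sets (the empty set would get 0, not -1).
dim : Subset n → ℕ
dim σ = ∣ σ ∣ ∸ 1

record Complex (n : ℕ) : Set where
  field
    simplices : Family n
    nonempty  : ∀ {σ} → σ ∈ simplices → Nonempty σ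
    closed    : ∀ {σ τ} → τ ∈ simplices → Nonempty σ → σ ⊆ τ → σ ∈ simplices

open Complex public

record FreePair (K : Complex n) (σ τ : Subset n) : Set where
  field
    lower∈ : σ ∈ simplices K
    upper∈ : τ ∈ simplices K
    proper : σ ⊂ τ
    only   : ∀ ρ → ρ ∈ simplices K → σ ⊆ ρ → ρ ≢ σ → ρ ≡ τ

record Facet (K : Complex n) (ν : Subset n) : Set where
  field
    facet∈  : ν ∈ simplices K
    maximal : ∀ ρ → ρ ∈ simplices K → ν ⊆ ρ → ρ ≡ ν

-- L is an elementary expansion of K, where K = L ∖ {σ , τ}.
record Expansion (K L : Complex n) (σ τ : Subset n) : Set where
  field
    free    : FreePair L σ τ
    removal : ∀ ρ → ρ ∈ simplices K ⇔ (ρ ∈ simplices L × ρ ≢ σ × ρ ≢ τ)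

-- L is an elementary filling of K, where K = L ∖ {ν}.
record Filling (K L : Complex n) (ν : Subset n) : Set where
  field
    facet   : Facet L ν
    removal : ∀ ρ → ρ ∈ simplices K ⇔ (ρ ∈ simplices L × ρ ≢ ν)

data MorseSequence {n : ℕ} : Complex n → Set where
  start  : ∀ {K} → (∀ ρ → ρ ∉ simplices K) → MorseSequence K
  expand : ∀ {K L} → MorseSequence K → (σ τ : Subset n) → Expansion K L σ τ → MorseSequence L
  fill   : ∀ {K L} → MorseSequence K → (ν : Subset n) → Filling K L ν → MorseSequence L

Critical : {K : Complex n} → MorseSequence K → Subset n → Set
Critical (start _)        ρ = ⊥
Critical (expand W _ _ _) ρ = Critical W ρ
Critical (fill W ν _)     ρ = Critical W ρ ⊎ ρ ≡ ν

RegularPair : {K : Complex n} → MorseSequence K → Subset n → Subset n → Set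
RegularPair (start _)        ρ π = ⊥
RegularPair (expand W σ τ _) ρ π = RegularPair W ρ π ⊎ (ρ ≡ σ × π ≡ τ)
RegularPair (fill W _ _)     ρ π = RegularPair W ρ π

LowerRegular : {K : Complex n} → MorseSequence K → Subset n → Set
LowerRegular W σ = ∃ λ τ → RegularPair W σ τ

UpperRegular : {K : Complex n} → MorseSequence K → Subset n → Set
UpperRegular W τ = ∃ λ σ → RegularPair W σ τ

∂ : Complex n → Subset n → Family n
∂ K σ τ = simplices K τ ∧ (suc (dim τ) ≡ᵇ dim σ) ∧ does (τ ⊆? σ)

δ : Complex n → Subset n → Family n
δ K σ τ = simplices K τ ∧ (dim τ ≡ᵇ suc (dim σ)) ∧ does (σ ⊆? τ)

-- Sum in ℤ₂ over all subsets of Fin n.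
⨁ : (Subset n → Bool) → Bool
⨁ {zero}  f = f []
⨁ {suc n} f = ⨁ (λ σ → f (outside ∷ σ)) xor ⨁ (λ σ → f (inside ∷ σ))

-- Linear extension to chains: the symmetric difference of the f σ, σ ∈ c.
linear : (Subset n → Family n) → Family n → Family n
linear f c ρ = ⨁ (λ σ → c σ ∧ f σ ρ)

-- The value of a (co)reference map on sets that are not simplices of K is
-- unconstrained; it never contributes, since ∂ and δ only contain simplices
-- of K.  The conditions determine the map on the simplices of K.
record ReferenceMap {n} {K : Complex n} (W : MorseSequence K) : Set where
  field
    map         : Subset n → Family n
    critical    : ∀ {σ} → σ ∈ simplices K → ∀ ν → ν ∈ map σ → Critical W ν × dim ν ≡ dim σ
    on-critical : ∀ {ν} → Critical W ν → ∀ ρ → ρ ∈ map ν ⇔ ρ ≡ ν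
    on-upper    : ∀ {τ} → UpperRegular W τ → ∀ ρ → ρ ∉ map τ
    on-∂-upper  : ∀ {τ} → UpperRegular W τ → ∀ ρ → ρ ∉ linear map (∂ K τ)

record CoreferenceMap {n} {K : Complex n} (W : MorseSequence K) : Set where
  field
    map         : Subset n → Family n
    critical    : ∀ {σ} → σ ∈ simplices K → ∀ ν → ν ∈ map σ → Critical W ν × dim ν ≡ dim σ
    on-critical : ∀ {ν} → Critical W ν → ∀ ρ → ρ ∈ map ν ⇔ ρ ≡ ν
    on-lower    : ∀ {σ} → LowerRegular W σ → ∀ ρ → ρ ∉ map σ
    on-δ-lower  : ∀ {σ} → LowerRegular W σ → ∀ ρ → ρ ∉ linear map (δ K σ)

∂̂ : {K : Complex n} {W : MorseSequence K} → ReferenceMap W → Subset n → Family n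
∂̂ {K = K} ⋏ ν = linear (ReferenceMap.map ⋏) (∂ K ν)

δ̂ : {K : Complex n} {W : MorseSequence K} → CoreferenceMap W → Subset n → Family n
δ̂ {K = K} ⋎ ν = linear (CoreferenceMap.map ⋎) (δ K ν)

{-# OPTIONS --safe #-}
module Submission where

-- Let A and B be the 0/1 matrices of ⋏ and ⋎, and D the incidence matrix of K.
-- The proof evaluates  ∑ B(y,τ) D(y,x) A(x,σ)  over simplices x, y in two ways.
-- Every simplex is critical, lower regular or upper regular.  Summing over x
-- first, the term at y vanishes if y is lower regular (⋎ y = 0), upper regular
-- (⋏ (∂ y) = 0), or critical and different from τ, so only y = τ survives and
-- gives the coefficient of σ in ∂̂ τ.  Summing over y first, only x = σ survives
-- and gives the coefficient of τ in δ̂ σ.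

open import Data.Bool using (Bool; true; false; T; _∧_; _xor_)
open import Data.Bool.Properties using (∧-assoc; ∧-comm; ∧-zeroʳ; ∧-distribˡ-xor; xor-identityʳ; T-≡; xor-∧-commutativeRing)
import Data.Bool.Properties as Bool
open import Data.Empty using (⊥-elim)
open import Data.Nat using (ℕ; zero; suc; _≡ᵇ_)
open import Data.Fin.Subset using (Subset; inside; outside)
open import Data.Fin.Subset.Properties using (_⊆?_)
open import Data.Product using (_,_; proj₁)
open import Data.Sum using (inj₁; inj₂)
open import Data.Vec using ([]; _∷_)
open import Data.Vec.Properties using (≡-dec)
open import Algebra.Bundles using (CommutativeRing)
open import Algebra.Properties.CommutativeSemigroup
  (CommutativeRing.+-commutativeSemigroup xor-∧-commutativeRing)
  using () renaming (interchange to xor-interchange)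
open import Function using (_∘_)
open import Function.Bundles using (_⇔_; mk⇔; Equivalence)
open import Relation.Binary using (DecidableEquality)
open import Relation.Binary.PropositionalEquality using (_≡_; _≢_; refl; sym; trans; cong; cong₂; subst; module ≡-Reasoning)
open import Relation.Nullary using (¬_; yes; no; does)
open import Defs

open Equivalence using (to; from)

private
  variable
    m n : ℕ

_≟_ : DecidableEquality (Subset n)
_≟_ = ≡-dec Bool._≟_

¬T⇒false : ∀ {b} → ¬ T b → b ≡ false
¬T⇒false {false} _  = refl
¬T⇒false {true}  ¬t = ⊥-elim (¬t _)

⨁-cong : {f g : Subset n → Bool} → (∀ σ → f σ ≡ g σ) → ⨁ f ≡ ⨁ g
⨁-cong {zero}  f≗g = f≗g []
⨁-cong {suc n} f≗g = cong₂ _xor_ (⨁-cong (f≗g ∘ (outside ∷_))) (⨁-cong (f≗g ∘ (inside ∷_)))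

⨁-false : {f : Subset n → Bool} → (∀ σ → f σ ≡ false) → ⨁ f ≡ false
⨁-false {zero}  f≗0 = f≗0 []
⨁-false {suc n} f≗0 = cong₂ _xor_ (⨁-false (f≗0 ∘ (outside ∷_))) (⨁-false (f≗0 ∘ (inside ∷_)))

⨁-xor : (f g : Subset n → Bool) → ⨁ (λ σ → f σ xor g σ) ≡ ⨁ f xor ⨁ g
⨁-xor {zero}  f g = refl
⨁-xor {suc n} f g = trans
  (cong₂ _xor_ (⨁-xor (f ∘ (outside ∷_)) (g ∘ (outside ∷_))) (⨁-xor (f ∘ (inside ∷_)) (g ∘ (inside ∷_))))
  (xor-interchange (⨁ (f ∘ (outside ∷_))) _ _ _)

∧-distribˡ-⨁ : ∀ b (f : Subset n → Bool) → b ∧ ⨁ f ≡ ⨁ (λ σ → b ∧ f σ)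
∧-distribˡ-⨁ {zero}  b f = refl
∧-distribˡ-⨁ {suc n} b f = trans
  (∧-distribˡ-xor b (⨁ (f ∘ (outside ∷_))) _)
  (cong₂ _xor_ (∧-distribˡ-⨁ b (f ∘ (outside ∷_))) (∧-distribˡ-⨁ b (f ∘ (inside ∷_))))

⨁-swap : (f : Subset m → Subset n → Bool) →
         ⨁ (λ σ → ⨁ (λ τ → f σ τ)) ≡ ⨁ (λ τ → ⨁ (λ σ → f σ τ))
⨁-swap {zero}  f = refl
⨁-swap {suc m} f = trans
  (cong₂ _xor_ (⨁-swap (f ∘ (outside ∷_))) (⨁-swap (f ∘ (inside ∷_))))
  (sym (⨁-xor (λ τ → ⨁ (λ σ → f (outside ∷ σ) τ)) _))

⨁-single : {f : Subset n → Bool} (τ : Subset n) → (∀ σ → σ ≢ τ → f σ ≡ false) → ⨁ f ≡ f τ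
⨁-single []                    f≗0 = refl
⨁-single {f = f} (outside ∷ τ) f≗0 = trans
  (cong₂ _xor_ (⨁-single τ λ σ σ≢τ → f≗0 (outside ∷ σ) λ { refl → σ≢τ refl }) (⨁-false λ σ → f≗0 (inside ∷ σ) λ ()))
  (xor-identityʳ (f (outside ∷ τ)))
⨁-single (inside ∷ τ)          f≗0 =
  cong₂ _xor_ (⨁-false λ σ → f≗0 (outside ∷ σ) λ ()) (⨁-single τ λ σ σ≢τ → f≗0 (inside ∷ σ) λ { refl → σ≢τ refl })

-- Each step of the sequence only enlarges the complex, so a simplex that is critical at some stage
-- still lies in the final one.
critical⇒∈ : {K : Complex n} (W : MorseSequence K) {ν : Subset n} → Critical W ν → ν ∈ simplices K
critical⇒∈ (expand W _ _ e) c        = proj₁ (to (Expansion.removal e _) (critical⇒∈ W c))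
critical⇒∈ (fill W _ f) (inj₁ c)     = proj₁ (to (Filling.removal f _) (critical⇒∈ W c))
critical⇒∈ (fill W _ f) (inj₂ refl)  = Facet.facet∈ (Filling.facet f)

data Kind {K : Complex n} (W : MorseSequence K) (ρ : Subset n) : Set where
  crit  : Critical W ρ → Kind W ρ
  lower : LowerRegular W ρ → Kind W ρ
  upper : UpperRegular W ρ → Kind W ρ

-- Induction along the sequence: a simplex was either added by the last step, which decides its
-- kind, or by `removal` it lies in the previous complex, whose critical simplices and regular pairs
-- are kept.
kind : {K : Complex n} (W : MorseSequence K) {ρ : Subset n} → ρ ∈ simplices K → Kind W ρ
kind (start ∉K) ρ∈K = ⊥-elim (∉K _ ρ∈K)
kind (expand W σ τ e) {ρ} ρ∈L with ρ ≟ σ | ρ ≟ τ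
... | yes ρ≡σ | _       = lower (τ , inj₂ (ρ≡σ , refl))
... | no _    | yes ρ≡τ = upper (σ , inj₂ (refl , ρ≡τ))
... | no ρ≢σ  | no ρ≢τ with kind W (from (Expansion.removal e ρ) (ρ∈L , ρ≢σ , ρ≢τ))
...   | crit c        = crit c
...   | lower (π , r) = lower (π , inj₁ r)
...   | upper (π , r) = upper (π , inj₁ r)
kind (fill W ν f) {ρ} ρ∈L with ρ ≟ ν
... | yes ρ≡ν = crit (inj₂ ρ≡ν)
... | no ρ≢ν with kind W (from (Filling.removal f ρ) (ρ∈L , ρ≢ν))
...   | crit c  = crit (inj₁ c)
...   | lower r = lower r
...   | upper r = upper r

≡ᵇ-comm : ∀ i j → (i ≡ᵇ j) ≡ (j ≡ᵇ i)
≡ᵇ-comm zero    zero    = refl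
≡ᵇ-comm zero    (suc j) = refl
≡ᵇ-comm (suc i) zero    = refl
≡ᵇ-comm (suc i) (suc j) = ≡ᵇ-comm i j

-- `∂ K τ σ` tests that `σ` is a simplex, `δ K σ τ` tests that `τ` is. Each side supplies the test
-- the other lacks, and the conditions on dimension and inclusion agree.
∂-δ-transpose : (K : Complex n) (σ τ : Subset n) →
                simplices K τ ∧ ∂ K τ σ ≡ simplices K σ ∧ δ K σ τ
∂-δ-transpose K σ τ rewrite ≡ᵇ-comm (suc (dim σ)) (dim τ) = begin
  Kτ ∧ (Kσ ∧ d)   ≡⟨ ∧-assoc Kτ Kσ d ⟨
  (Kτ ∧ Kσ) ∧ d   ≡⟨ cong (_∧ d) (∧-comm Kτ Kσ) ⟩
  (Kσ ∧ Kτ) ∧ d   ≡⟨ ∧-assoc Kσ Kτ d ⟩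
  Kσ ∧ (Kτ ∧ d)   ∎
  where
  open ≡-Reasoning
  Kσ = simplices K σ
  Kτ = simplices K τ
  d  = (dim τ ≡ᵇ suc (dim σ)) ∧ does (σ ⊆? τ)

-- Brings the simplex indicator `a` next to the incidence coefficient `c`, the shape in which
-- `∂-δ-transpose` applies.
∧-interchange : ∀ a b c d → (a ∧ b) ∧ (c ∧ d) ≡ (a ∧ c) ∧ (d ∧ b)
∧-interchange false b c d = refl
∧-interchange true  b c d = trans (∧-comm b (c ∧ d)) (∧-assoc c d b)

-- The factor `simplices K ρ` confines the sum to sets that `kind` can classify; outside `K` the
-- values of the two maps are unconstrained.
∑-simplices-single : (K : Complex n) (b g : Subset n → Bool) {τ : Subset n} → τ ∈ simplices K → T (b τ) →
                     (∀ {ρ} → ρ ∈ simplices K → ρ ≢ τ → b ρ ∧ g ρ ≡ false) →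
                     ⨁ (λ ρ → (simplices K ρ ∧ b ρ) ∧ g ρ) ≡ g τ
∑-simplices-single K b g {τ} τ∈K bτ vanish = trans
  (⨁-single τ off)
  (cong (_∧ g τ) (cong₂ _∧_ (to T-≡ τ∈K) (to T-≡ bτ)))
  where
  off : ∀ ρ → ρ ≢ τ → (simplices K ρ ∧ b ρ) ∧ g ρ ≡ false
  off ρ ρ≢τ with simplices K ρ in eq
  ... | false = refl
  ... | true  = vanish (from T-≡ eq) ρ≢τ

module _ {K : Complex n} {W : MorseSequence K} (⋏ : ReferenceMap W) (⋎ : CoreferenceMap W)
         {σ τ : Subset n} (σ-crit : Critical W σ) (τ-crit : Critical W τ) where

  open ReferenceMap ⋏ using () renaming (map to ⋏-map)
  open CoreferenceMap ⋎ using () renaming (map to ⋎-map)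

  sum-over-cofaces : ⨁ (λ y → (simplices K y ∧ ⋎-map y τ) ∧ ∂̂ ⋏ y σ) ≡ ∂̂ ⋏ τ σ
  sum-over-cofaces = ∑-simplices-single K (λ y → ⋎-map y τ) (λ y → ∂̂ ⋏ y σ)
    (critical⇒∈ W τ-crit) (from (CoreferenceMap.on-critical ⋎ τ-crit τ) refl) vanish
    where
    vanish : ∀ {y} → y ∈ simplices K → y ≢ τ → ⋎-map y τ ∧ ∂̂ ⋏ y σ ≡ false
    vanish {y} y∈K y≢τ with kind W y∈K
    ... | crit c  = cong (_∧ ∂̂ ⋏ y σ) (¬T⇒false (y≢τ ∘ sym ∘ to (CoreferenceMap.on-critical ⋎ c τ)))
    ... | lower r = cong (_∧ ∂̂ ⋏ y σ) (¬T⇒false (CoreferenceMap.on-lower ⋎ r τ))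
    -- `∂̂ ⋏ y` unfolds to the reference map applied to `∂ K y` for every `y`, critical or not, so
    -- the condition on boundaries of upper regular simplices applies directly.
    ... | upper r = trans (cong (⋎-map y τ ∧_) (¬T⇒false (ReferenceMap.on-∂-upper ⋏ r σ))) (∧-zeroʳ _)

  sum-over-faces : ⨁ (λ x → (simplices K x ∧ ⋏-map x σ) ∧ δ̂ ⋎ x τ) ≡ δ̂ ⋎ σ τ
  sum-over-faces = ∑-simplices-single K (λ x → ⋏-map x σ) (λ x → δ̂ ⋎ x τ)
    (critical⇒∈ W σ-crit) (from (ReferenceMap.on-critical ⋏ σ-crit σ) refl) vanish
    where
    vanish : ∀ {x} → x ∈ simplices K → x ≢ σ → ⋏-map x σ ∧ δ̂ ⋎ x τ ≡ false
    vanish {x} x∈K x≢σ with kind W x∈K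
    ... | crit c  = cong (_∧ δ̂ ⋎ x τ) (¬T⇒false (x≢σ ∘ sym ∘ to (ReferenceMap.on-critical ⋏ c σ)))
    ... | upper r = cong (_∧ δ̂ ⋎ x τ) (¬T⇒false (ReferenceMap.on-upper ⋏ r σ))
    -- Dually, `δ̂ ⋎ x` is the coreference map applied to `δ K x`, which vanishes when `x` is lower
    -- regular.
    ... | lower r = trans (cong (⋏-map x σ ∧_) (¬T⇒false (CoreferenceMap.on-δ-lower ⋎ r τ))) (∧-zeroʳ _)

  -- Both coefficients are values of one double sum mod 2, evaluated in either order.
  ∂̂-δ̂-transpose : ∂̂ ⋏ τ σ ≡ δ̂ ⋎ σ τ
  ∂̂-δ̂-transpose = begin
    ∂̂ ⋏ τ σ
      ≡⟨ sum-over-cofaces ⟨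
    ⨁ (λ y → (simplices K y ∧ ⋎-map y τ) ∧ ∂̂ ⋏ y σ)
      ≡⟨ ⨁-cong (λ y → ∧-distribˡ-⨁ (simplices K y ∧ ⋎-map y τ) (λ x → ∂ K y x ∧ ⋏-map x σ)) ⟩
    ⨁ (λ y → ⨁ (λ x → (simplices K y ∧ ⋎-map y τ) ∧ (∂ K y x ∧ ⋏-map x σ)))
      ≡⟨ ⨁-swap (λ y x → (simplices K y ∧ ⋎-map y τ) ∧ (∂ K y x ∧ ⋏-map x σ)) ⟩
    ⨁ (λ x → ⨁ (λ y → (simplices K y ∧ ⋎-map y τ) ∧ (∂ K y x ∧ ⋏-map x σ)))
      -- The simplex indicator passes from `y` to `x`, so that the inner sum over `y` can be folded
      -- into `δ̂ ⋎ x τ`.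
      ≡⟨ ⨁-cong (λ x → ⨁-cong (summand x)) ⟩
    ⨁ (λ x → ⨁ (λ y → (simplices K x ∧ ⋏-map x σ) ∧ (δ K x y ∧ ⋎-map y τ)))
      ≡⟨ ⨁-cong (λ x → ∧-distribˡ-⨁ (simplices K x ∧ ⋏-map x σ) (λ y → δ K x y ∧ ⋎-map y τ)) ⟨
    ⨁ (λ x → (simplices K x ∧ ⋏-map x σ) ∧ δ̂ ⋎ x τ)
      ≡⟨ sum-over-faces ⟩
    δ̂ ⋎ σ τ ∎
    where
    open ≡-Reasoning
    summand : ∀ x y → (simplices K y ∧ ⋎-map y τ) ∧ (∂ K y x ∧ ⋏-map x σ)
                    ≡ (simplices K x ∧ ⋏-map x σ) ∧ (δ K x y ∧ ⋎-map y τ)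
    summand x y = begin
      (simplices K y ∧ ⋎-map y τ) ∧ (∂ K y x ∧ ⋏-map x σ)
        ≡⟨ ∧-interchange (simplices K y) (⋎-map y τ) (∂ K y x) (⋏-map x σ) ⟩
      (simplices K y ∧ ∂ K y x) ∧ (⋏-map x σ ∧ ⋎-map y τ)
        ≡⟨ cong₂ _∧_ (∂-δ-transpose K x y) (∧-comm (⋏-map x σ) (⋎-map y τ)) ⟩
      (simplices K x ∧ δ K x y) ∧ (⋎-map y τ ∧ ⋏-map x σ)
        ≡⟨ ∧-interchange (simplices K x) (⋏-map x σ) (δ K x y) (⋎-map y τ) ⟨
      (simplices K x ∧ ⋏-map x σ) ∧ (δ K x y ∧ ⋎-map y τ) ∎

theorem3 : (n : ℕ) (K : Complex n) (W : MorseSequence K)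
    (⋏ : ReferenceMap W) (⋎ : CoreferenceMap W)
    (σ τ : Subset n) → Critical W σ → Critical W τ →
    (σ ∈ ∂̂ ⋏ τ) ⇔ (τ ∈ δ̂ ⋎ σ)
theorem3 n K W ⋏ ⋎ σ τ σ-crit τ-crit = mk⇔ (subst T eq) (subst T (sym eq))
  where eq = ∂̂-δ̂-transpose ⋏ ⋎ σ-crit τ-crit
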